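{- Let $B$ be a Boolean algebra and let $U,V,W$ be CFG-spaces over $B$ with $U\cup V\subset W$ (the metrics on $U$ and $V$ being the restrictions of that of $W$), and let $F:U\to V$ be an isometry. Then there is an isometry $F':W\to W$ whose restriction to $U$ is $F$.
   Context: A Boolean metric space over a Boolean algebra $B$ is a set $X$ with a symmetric map $d:X\times X\to B$ such that $d(x,y)=0$ iff $x=y$, and $d(x,z)\le d(x,y)\vee d(y,z)$ for all $x,y,z$. A map $f:X\to Y$ between such spaces is contractive if $d(f(x),f(y))\le d(x,y)$ for all $x,y$; an isometry is a bijection with $d(f(x),f(y))=d(x,y)$ for all $x,y$. A partition of $B$ is a finite family $a_0,\dots,a_n$ of pairwise disjoint elements ($a_i\wedge a_j=0$ for $i\ne j$) with $a_0\vee\dots\vee a_n=1$. Given $x_0,\dots,x_n\in X$ and a partition $a_0,\dots,a_n$, an element $x\in X$ is a convex combination of the $x_i$ with coefficients $a_i$ if $a_i\wedge d(x,x_i)=0$ for all $i$. $X$ is convex if for every $x_0,\dots,x_n\in X$ and every partition $a_0,\dots,a_n$ of $B$ there exists such a convex combination in $X$; $X$ is finitely generated if there is a finite $S\subset X$ such that every element of $X$ is a convex combination of elements of $S$. A CFG-space is a convex, finitely generated Boolean metric space. -}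

module Defs where

open import Algebra.Lattice.Bundles using (BooleanAlgebra)
import Algebra.Lattice.Properties.BooleanAlgebra as BooleanAlgebraProperties
open import Data.List.Base using (List)
import Data.List.Membership.Setoid as Membership
open import Data.Nat.Base using (suc)
open import Data.Product.Base using (∃; ∃-syntax; Σ-syntax; _×_; proj₁)
open import Data.Vec.Functional using (Vector; foldr)
open import Function.Bundles using (Bijection)
open import Function.Metric.Structures using (IsGeneralMetric)
open import Level using (Level; _⊔_) renaming (suc to lsuc)
open import Relation.Binary.Bundles using (Poset; Setoid)
open import Relation.Binary.Core using (Rel)
import Relation.Binary.Construct.On as On
open import Relation.Binary.PropositionalEquality.Core using (_≢_)
open import Relation.Unary using (Pred)

private
  variable
    b ℓ c c₁ c₂ e e₁ e₂ u : Level

module _ (B : BooleanAlgebra b ℓ) where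

  private module B = BooleanAlgebra B
  open BooleanAlgebraProperties B using (poset)
  open Poset poset using (_≤_)

  ⋁ : ∀ {n} → Vector B.Carrier n → B.Carrier
  ⋁ = foldr B._∨_ B.⊥

  record IsPartition {n} (a : Vector B.Carrier (suc n)) : Set ℓ where
    field
      disjoint : ∀ {i j} → i ≢ j → (a i B.∧ a j) B.≈ B.⊥
      covering : ⋁ a B.≈ B.⊤

  -- Points are compared by the setoid equality _≈_, so "d(x,y) = 0 iff x = y"
  -- reads d x y ≈ ⊥ iff x ≈ y.  The remaining laws of IsGeneralMetric
  -- (⊥ is below every distance, _≤_ is a partial order, d is a congruence)
  -- are automatic consequences of the axioms of a Boolean metric.
  record BooleanMetricSpace c e : Set (b ⊔ ℓ ⊔ lsuc (c ⊔ e)) where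
    infix 4 _≈_
    field
      Carrier         : Set c
      _≈_             : Rel Carrier e
      d               : Carrier → Carrier → B.Carrier
      isBooleanMetric : IsGeneralMetric _≈_ B._≈_ _≤_ B.⊥ B._∨_ d

    open IsGeneralMetric isBooleanMetric public

    setoid : Setoid c e
    setoid = record { isEquivalence = ≈-isEquivalence }

module _ {B : BooleanAlgebra b ℓ} where

  private module B = BooleanAlgebra B

  Subspace : (X : BooleanMetricSpace B c e) →
             Pred (BooleanMetricSpace.Carrier X) u →
             BooleanMetricSpace B (c ⊔ u) e
  Subspace X U = record
    { Carrier         = ∃ U
    ; _≈_             = λ x y → proj₁ x X.≈ proj₁ y
    ; d               = λ x y → X.d (proj₁ x) (proj₁ y)
    ; isBooleanMetric = record
      { isSemiMetric = record
        { isQuasiSemiMetric = record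
          { isPreMetric = record
            { isProtoMetric = record
              { isPartialOrder  = X.isPartialOrder
              ; ≈-isEquivalence = On.isEquivalence proj₁ X.≈-isEquivalence
              ; cong            = X.cong
              ; nonNegative     = X.nonNegative
              }
            ; ≈⇒0 = X.≈⇒0
            }
          ; 0⇒≈ = X.0⇒≈
          }
        ; sym = λ x y → X.sym (proj₁ x) (proj₁ y)
        }
      ; triangle = λ x y z → X.triangle (proj₁ x) (proj₁ y) (proj₁ z)
      }
    }
    where module X = BooleanMetricSpace X

  record Isometry (X : BooleanMetricSpace B c₁ e₁)
                  (Y : BooleanMetricSpace B c₂ e₂)
                  : Set (ℓ ⊔ c₁ ⊔ e₁ ⊔ c₂ ⊔ e₂) where
    private
      module X = BooleanMetricSpace X
      module Y = BooleanMetricSpace Y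
    field
      bijection : Bijection X.setoid Y.setoid

    open Bijection bijection public using (to)

    field
      isometric : ∀ x y → Y.d (to x) (to y) B.≈ X.d x y

  module _ (X : BooleanMetricSpace B c e) where

    private module X = BooleanMetricSpace X
    open Membership X.setoid using (_∈_)

    IsConvexCombination : ∀ {n} → Vector B.Carrier (suc n) →
                          Vector X.Carrier (suc n) → X.Carrier → Set ℓ
    IsConvexCombination a xs x = ∀ i → (a i B.∧ X.d x (xs i)) B.≈ B.⊥

    Convex : Set (b ⊔ ℓ ⊔ c)
    Convex = ∀ {n} (xs : Vector X.Carrier (suc n))
             (a : Vector B.Carrier (suc n)) → IsPartition B a →
             ∃[ x ] IsConvexCombination a xs x

    -- The family (xs i) may repeat or omit elements of S, but it is nonempty;
    -- in particular only the empty space is generated by the empty list.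
    Generates : List X.Carrier → Set (b ⊔ ℓ ⊔ c ⊔ e)
    Generates S = ∀ x →
      ∃[ n ] Σ[ xs ∈ Vector X.Carrier (suc n) ]
             Σ[ a ∈ Vector B.Carrier (suc n) ]
        (∀ i → xs i ∈ S) × IsPartition B a × IsConvexCombination a xs x

    FinitelyGenerated : Set (b ⊔ ℓ ⊔ c ⊔ e)
    FinitelyGenerated = ∃[ S ] Generates S

    record IsCFGSpace : Set (b ⊔ ℓ ⊔ c ⊔ e) where
      field
        convex            : Convex
        finitelyGenerated : FinitelyGenerated

{-# OPTIONS --safe #-}

-- For points p, q of a convex space W let τ be the transposition of p and q:
-- τ z equals q where z = p, p where z = q, and z elsewhere.  It is an
-- isometric involution of W.  Suppose that an isometry G of W agrees with F on
-- the generators s of U treated so far, let u be a further generator, and let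
-- τ exchange p = G u and q = F u.  Then τ ∘ G sends u to F u, and τ fixes
-- every F s because d(F s, p) = d(G s, G u) = d(s, u) = d(F s, q).  Induction
-- thus yields an isometry of W that agrees with F on the generators of U,
-- hence on U.
module Submission where

open import Defs
open import Algebra.Lattice.Bundles using (BooleanAlgebra)
import Algebra.Lattice.Properties.BooleanAlgebra as BooleanAlgebraProperties
open import Data.Fin.Base using (zero; suc)
open import Data.List.Base using ([]; _∷_)
open import Data.List.Relation.Unary.All as All using (All; []; _∷_)
open import Data.Nat.Base using (zero; suc)
open import Data.Product.Base using (∃-syntax; Σ-syntax; _,_; proj₁; proj₂)
open import Data.Vec.Functional using (Vector) renaming ([] to ⟨⟩; _∷_ to _◂_)
open import Function.Bundles using (Bijection)
import Function.Construct.Composition as Composition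
import Function.Construct.Identity as Identity
open import Level using (Level)
open import Relation.Binary.Definitions using (_Respects_)
open import Relation.Binary.Lattice.Bundles using (Lattice)
import Relation.Binary.Lattice.Properties.JoinSemilattice as JoinProperties
import Relation.Binary.Lattice.Properties.MeetSemilattice as MeetProperties
open import Relation.Binary.PropositionalEquality.Core using (_≢_; refl)
import Relation.Binary.Reasoning.Setoid as SetoidReasoning
open import Relation.Nullary.Negation.Core using (contradiction)
open import Relation.Unary using (Pred)

private
  variable
    b ℓ c e c₁ c₂ c₃ e₁ e₂ e₃ : Level

-- Inequalities and partitions in a Boolean algebra.

module BooleanOrder (B : BooleanAlgebra b ℓ) where

  open BooleanAlgebra B renaming (sym to ≈-sym; trans to ≈-trans; refl to ≈-refl)
  open BooleanAlgebraProperties B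
    using (∧-identityʳ; ∧-identityˡ; ∨-identityʳ; ∨-identityˡ; ∧-zeroˡ;
           deMorgan₁; deMorgan₂; ¬-involutive; ∨-∧-orderTheoreticLattice)
  open Lattice ∨-∧-orderTheoreticLattice public
    using (_≤_; x≤x∨y; y≤x∨y; ∨-least; x∧y≤x; x∧y≤y; ∧-greatest;
           joinSemilattice; meetSemilattice)
    renaming (refl to ≤-refl; reflexive to ≤-reflexive; trans to ≤-trans; antisym to ≤-antisym)
  open JoinProperties joinSemilattice public using (∨-monotonic)
  open MeetProperties meetSemilattice public using (∧-monotonic)

  ⊥-least : ∀ x → ⊥ ≤ x
  ⊥-least x = ≈-sym (∧-zeroˡ x)

  ≤⊥⇒≈⊥ : ∀ {x} → x ≤ ⊥ → x ≈ ⊥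
  ≤⊥⇒≈⊥ x≤⊥ = ≤-antisym x≤⊥ (⊥-least _)

  -- A bound by `x` may be checked first outside `y` and then inside `y`. This stands in for
  -- deciding whether two points are equal, as equality holds on one part of the algebra and fails
  -- on the rest.
  ∨-¬-cancel : ∀ {x y z} → z ≤ x ∨ y → z ≤ x ∨ ¬ y → z ≤ x
  ∨-¬-cancel {x} {y} z≤x∨y z≤x∨¬y = ≤-trans (∧-greatest z≤x∨y z≤x∨¬y) (≤-reflexive (begin
    (x ∨ y) ∧ (x ∨ ¬ y)  ≈⟨ ∨-distribˡ-∧ x y (¬ y) ⟨
    x ∨ (y ∧ ¬ y)        ≈⟨ ∨-congˡ (∧-complementʳ y) ⟩
    x ∨ ⊥                ≈⟨ ∨-identityʳ x ⟩
    x                    ∎))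
    where open SetoidReasoning setoid

  ∨-∧-greatest : ∀ {x y z w} → w ≤ x ∨ y → w ≤ x ∨ z → w ≤ x ∨ (y ∧ z)
  ∨-∧-greatest w≤x∨y w≤x∨z =
    ≤-trans (∧-greatest w≤x∨y w≤x∨z) (≤-reflexive (≈-sym (∨-distribˡ-∧ _ _ _)))

  -- The elements `¬ y`, `¬ z` and `y ∧ z` cover the algebra, so a bound may be checked on each of
  -- them. With `y` and `z` the distances of a point to `p` and to `q`, these are the regions where
  -- it is `p`, is `q`, and is neither.
  ∨-cases : ∀ {x y z w} → w ≤ x ∨ y → w ≤ x ∨ z → w ≤ x ∨ ¬ (y ∧ z) → w ≤ x
  ∨-cases w≤x∨y w≤x∨z = ∨-¬-cancel (∨-∧-greatest w≤x∨y w≤x∨z)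

  x≤y∨¬y : ∀ x y → x ≤ y ∨ ¬ y
  x≤y∨¬y x y = ≈-trans (≈-sym (∧-identityʳ x)) (∧-congˡ (≈-sym (∨-complementʳ y)))

  disjoint⇒≤¬ : ∀ {x y} → x ∧ y ≈ ⊥ → y ≤ ¬ x
  disjoint⇒≤¬ {x} {y} x∧y≈⊥ = begin
    y                    ≈⟨ x≤y∨¬y y x ⟩
    y ∧ (x ∨ ¬ x)        ≈⟨ ∧-distribˡ-∨ y x (¬ x) ⟩
    (y ∧ x) ∨ (y ∧ ¬ x)  ≈⟨ ∨-congʳ (≈-trans (∧-comm y x) x∧y≈⊥) ⟩
    ⊥ ∨ (y ∧ ¬ x)        ≈⟨ ∨-identityˡ _ ⟩
    y ∧ ¬ x              ∎
    where open SetoidReasoning setoid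

  ≤¬⇒disjoint : ∀ {x y} → y ≤ ¬ x → x ∧ y ≈ ⊥
  ≤¬⇒disjoint {x} y≤¬x =
    ≤⊥⇒≈⊥ (≤-trans (∧-monotonic ≤-refl y≤¬x) (≤-reflexive (∧-complementʳ x)))

  ¬-antitone : ∀ {x y} → x ≤ y → ¬ y ≤ ¬ x
  ¬-antitone {x} {y} x≤y = disjoint⇒≤¬
    (≤⊥⇒≈⊥ (≤-trans (∧-monotonic x≤y ≤-refl) (≤-reflexive (∧-complementʳ y))))

  -- Contraposition outside `x`: below `¬ x` the hypothesis reads `y ≤ z`, and below `x` there is
  -- nothing to prove.
  ¬-≤-∨ : ∀ {x y z} → y ≤ x ∨ z → ¬ z ≤ x ∨ ¬ y
  ¬-≤-∨ {x} {y} {z} y≤x∨z = ≤-trans (∨-∧-greatest (x≤y∨¬y (¬ z) x) (y≤x∨y _ _))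
    (∨-monotonic ≤-refl (≤-trans (≤-reflexive (≈-sym (deMorgan₂ x z))) (¬-antitone y≤x∨z)))

  ¬[x∧¬y]≤y∨¬x : ∀ x y → ¬ (x ∧ ¬ y) ≤ y ∨ ¬ x
  ¬[x∧¬y]≤y∨¬x x y = ≤-reflexive (begin
    ¬ (x ∧ ¬ y)    ≈⟨ deMorgan₁ x (¬ y) ⟩
    ¬ x ∨ ¬ (¬ y)  ≈⟨ ∨-congˡ (¬-involutive y) ⟩
    ¬ x ∨ y        ≈⟨ ∨-comm _ _ ⟩
    y ∨ ¬ x        ∎)
    where open SetoidReasoning setoid

  ⋁-disjoint : ∀ n (a : Vector Carrier n) {x} → (∀ i → a i ∧ x ≈ ⊥) → ⋁ B a ∧ x ≈ ⊥
  ⋁-disjoint zero    a {x} a∧x≈⊥ = ∧-zeroˡ x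
  ⋁-disjoint (suc n) a {x} a∧x≈⊥ = begin
    (a zero ∨ ⋁ B a′) ∧ x        ≈⟨ ∧-distribʳ-∨ x _ _ ⟩
    (a zero ∧ x) ∨ (⋁ B a′ ∧ x)  ≈⟨ ∨-cong (a∧x≈⊥ zero) (⋁-disjoint n a′ λ i → a∧x≈⊥ (suc i)) ⟩
    ⊥ ∨ ⊥                        ≈⟨ ∨-identityˡ ⊥ ⟩
    ⊥                            ∎
    where
    open SetoidReasoning setoid
    a′ : Vector Carrier n
    a′ i = a (suc i)

  partition-disjoint : ∀ {n} {a : Vector Carrier (suc n)} {x} → IsPartition B a →
                       (∀ i → a i ∧ x ≈ ⊥) → x ≈ ⊥
  partition-disjoint {a = a} {x} a-partition a∧x≈⊥ = begin
    x          ≈⟨ ∧-identityˡ x ⟨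
    ⊤ ∧ x      ≈⟨ ∧-congʳ (IsPartition.covering a-partition) ⟨
    ⋁ B a ∧ x  ≈⟨ ⋁-disjoint _ a a∧x≈⊥ ⟩
    ⊥          ∎
    where open SetoidReasoning setoid

  -- For `x = d z p` and `y = d z q` the pieces are the regions where `z` is `p`, where it is `q`
  -- but not `p`, and where it is neither. The overlap of the first two cases goes to the first
  -- piece, which keeps the pieces disjoint.
  splitting : Carrier → Carrier → Vector Carrier 3
  splitting x y = ¬ x ◂ (x ∧ ¬ y) ◂ (x ∧ y) ◂ ⟨⟩

  splitting-isPartition : ∀ x y → IsPartition B (splitting x y)
  splitting-isPartition x y = record { disjoint = disjoint _ _ ; covering = covering }
    where
    open SetoidReasoning setoid

    a : Vector Carrier 3
    a = splitting x y

    0#1 : ∀ z → ¬ x ∧ (x ∧ z) ≈ ⊥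
    0#1 z = begin
      ¬ x ∧ (x ∧ z)  ≈⟨ ∧-assoc _ _ _ ⟨
      (¬ x ∧ x) ∧ z  ≈⟨ ∧-congʳ (∧-complementˡ x) ⟩
      ⊥ ∧ z          ≈⟨ ∧-zeroˡ z ⟩
      ⊥              ∎

    1#2 : (x ∧ ¬ y) ∧ (x ∧ y) ≈ ⊥
    1#2 = ≤⊥⇒≈⊥ (≤-trans (∧-monotonic (x∧y≤y _ _) (x∧y≤y _ _)) (≤-reflexive (∧-complementˡ y)))

    swap : ∀ {z w} → z ∧ w ≈ ⊥ → w ∧ z ≈ ⊥
    swap = ≈-trans (∧-comm _ _)

    disjoint : ∀ i j → i ≢ j → a i ∧ a j ≈ ⊥
    disjoint zero             zero             i≢j = contradiction refl i≢j
    disjoint zero             (suc zero)       _   = 0#1 _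
    disjoint zero             (suc (suc zero)) _   = 0#1 _
    disjoint (suc zero)       zero             _   = swap (0#1 _)
    disjoint (suc zero)       (suc zero)       i≢j = contradiction refl i≢j
    disjoint (suc zero)       (suc (suc zero)) _   = 1#2
    disjoint (suc (suc zero)) zero             _   = swap (0#1 _)
    disjoint (suc (suc zero)) (suc zero)       _   = swap 1#2
    disjoint (suc (suc zero)) (suc (suc zero)) i≢j = contradiction refl i≢j

    covering : ⋁ B a ≈ ⊤
    covering = begin
      ¬ x ∨ ((x ∧ ¬ y) ∨ ((x ∧ y) ∨ ⊥))  ≈⟨ ∨-congˡ (∨-congˡ (∨-identityʳ _)) ⟩
      ¬ x ∨ ((x ∧ ¬ y) ∨ (x ∧ y))        ≈⟨ ∨-congˡ (∧-distribˡ-∨ x (¬ y) y) ⟨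
      ¬ x ∨ (x ∧ (¬ y ∨ y))              ≈⟨ ∨-congˡ (∧-congˡ (∨-complementˡ y)) ⟩
      ¬ x ∨ (x ∧ ⊤)                      ≈⟨ ∨-congˡ (∧-identityʳ x) ⟩
      ¬ x ∨ x                            ≈⟨ ∨-complementˡ x ⟩
      ⊤                                  ∎

-- Isometries, and equality of points on a part of the algebra.

module _ {B : BooleanAlgebra b ℓ} where

  private module B = BooleanAlgebra B

  identity : (X : BooleanMetricSpace B c e) → Isometry X X
  identity X = record
    { bijection = Identity.bijection (BooleanMetricSpace.setoid X)
    ; isometric = λ _ _ → B.refl
    }

  compose : {X : BooleanMetricSpace B c₁ e₁} {Y : BooleanMetricSpace B c₂ e₂}
            {Z : BooleanMetricSpace B c₃ e₃} → Isometry X Y → Isometry Y Z → Isometry X Z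
  compose f g = record
    { bijection = Composition.bijection (Isometry.bijection f) (Isometry.bijection g)
    ; isometric = λ x y → B.trans (Isometry.isometric g _ _) (Isometry.isometric f x y)
    }

  module Modulo (X : BooleanMetricSpace B c e) where

    open BooleanMetricSpace X
    open BooleanOrder B

    infix 4 _≈[_]_

    -- x and y coincide on the complement of k.
    _≈[_]_ : Carrier → B.Carrier → Carrier → Set ℓ
    x ≈[ k ] y = d x y ≤ k

    ≈⇒≈[] : ∀ {k x y} → x ≈ y → x ≈[ k ] y
    ≈⇒≈[] x≈y = ≤-trans (≤-reflexive (≈⇒0 x≈y)) (⊥-least _)

    ≈[⊥]⇒≈ : ∀ {x y} → x ≈[ B.⊥ ] y → x ≈ y
    ≈[⊥]⇒≈ x≈y = 0⇒≈ (≤⊥⇒≈⊥ x≈y)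

    ≈[]-sym : ∀ {k x y} → x ≈[ k ] y → y ≈[ k ] x
    ≈[]-sym x≈y = ≤-trans (≤-reflexive (sym _ _)) x≈y

    ≈[]-trans : ∀ {k x y z} → x ≈[ k ] y → y ≈[ k ] z → x ≈[ k ] z
    ≈[]-trans x≈y y≈z = ≤-trans (triangle _ _ _) (∨-least x≈y y≈z)

  module _ {X : BooleanMetricSpace B c e} where

    open BooleanMetricSpace X
    open BooleanOrder B
    open Modulo X

    -- Contractivity at `f x` and `f y` gives the reverse inequality, since `f` undoes itself.
    -- Congruence of `f` is contractivity at distance `⊥`, so a map built from chosen convex
    -- combinations needs no separate argument that it respects equality.
    contractiveInvolution⇒isometry :
      (f : Carrier → Carrier) → (∀ x y → d (f x) (f y) ≤ d x y) → (∀ x → f (f x) ≈ x) →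
      Isometry X X
    contractiveInvolution⇒isometry f contractive involutive = record
      { bijection = record
        { to        = f
        ; cong      = f-cong
        ; bijective =
            (λ fx≈fy → EqC.trans (EqC.sym (involutive _))
                                 (EqC.trans (f-cong fx≈fy) (involutive _)))
          , (λ y → f y , λ z≈fy → EqC.trans (f-cong z≈fy) (involutive y))
        }
      ; isometric = λ x y → ≤-antisym (contractive x y)
          (≤-trans (≤-reflexive (cong (EqC.sym (involutive x)) (EqC.sym (involutive y))))
                   (contractive (f x) (f y)))
      }
      where
      f-cong : ∀ {x y} → x ≈ y → f x ≈ f y
      f-cong x≈y = ≈[⊥]⇒≈ (≤-trans (contractive _ _) (≈⇒≈[] x≈y))

    -- The transposition of two points.

    module Transposition (convex : Convex X) (p q : Carrier) where

      private
        combination : ∀ z → ∃[ y ]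
          IsConvexCombination X (splitting (d z p) (d z q)) (q ◂ p ◂ z ◂ ⟨⟩) y
        combination z = convex _ _ (splitting-isPartition _ _)

      τ : Carrier → Carrier
      τ z = proj₁ (combination z)

      τ≈q : ∀ {k z} → z ≈[ k ] p → τ z ≈[ k ] q
      τ≈q {z = z} z≈p = ≤-trans
        -- The first coefficient only bounds the distance by `¬ (¬ d z p)`; the cancellation removes
        -- the double negation.
        (∨-¬-cancel (x≤y∨¬y _ _) (≤-trans (disjoint⇒≤¬ (proj₂ (combination z) zero)) (y≤x∨y _ _)))
        z≈p

      τ≈z : ∀ z → τ z ≈[ B.¬ (d z p B.∧ d z q) ] z
      τ≈z z = disjoint⇒≤¬ (proj₂ (combination z) (suc (suc zero)))

      -- This is not the mirror image of `τ≈q`, because `splitting` favours `p`. Where `z` is both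
      -- `p` and `q`, the point `τ z` was chosen to be `q`, which is `z` and hence `p` there; where
      -- `z` is `q` but not `p`, the second coefficient applies.
      τ≈p : ∀ {k z} → z ≈[ k ] q → τ z ≈[ k ] p
      τ≈p {z = z} z≈q = ≤-trans (∨-¬-cancel where-z≈p elsewhere) z≈q
        where
        where-z≈p : τ z ≈[ d z q B.∨ d z p ] p
        where-z≈p = ≈[]-trans (τ≈q (y≤x∨y _ _)) (≈[]-trans (≈[]-sym (x≤x∨y _ _)) (y≤x∨y _ _))

        elsewhere : τ z ≈[ d z q B.∨ B.¬ d z p ] p
        elsewhere = ≤-trans (disjoint⇒≤¬ (proj₂ (combination z) (suc zero))) (¬[x∧¬y]≤y∨¬x _ _)

      -- Points may be compared separately where z is p, where z is q, and elsewhere.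
      cases : ∀ {k x y} z →
              (z ≈[ k B.∨ d z p ] p → x ≈[ k B.∨ d z p ] y) →
              (z ≈[ k B.∨ d z q ] q → x ≈[ k B.∨ d z q ] y) →
              (τ z ≈[ k B.∨ B.¬ (d z p B.∧ d z q) ] z → x ≈[ k B.∨ B.¬ (d z p B.∧ d z q) ] y) →
              x ≈[ k ] y
      cases z at-p at-q elsewhere =
        ∨-cases (at-p (y≤x∨y _ _)) (at-q (y≤x∨y _ _)) (elsewhere (≤-trans (τ≈z z) (y≤x∨y _ _)))

      -- Modulo `d x y` the points `x` and `y` coincide, so `y` falls under the same case as `x` and
      -- both have the same image.
      τ-contractive : ∀ x y → d (τ x) (τ y) ≤ d x y
      τ-contractive x y = cases x
        (λ x≈p → ≈[]-trans (τ≈q x≈p) (≈[]-sym (τ≈q (≈[]-trans y≈x x≈p))))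
        (λ x≈q → ≈[]-trans (τ≈p x≈q) (≈[]-sym (τ≈p (≈[]-trans y≈x x≈q))))
        (λ τx≈x → ≈[]-trans τx≈x (≈[]-trans (x≤x∨y _ _) (≈[]-sym (≤-trans (τ≈z y) ¬-bound))))
        where
        y≈x : ∀ {k} → y ≈[ d x y B.∨ k ] x
        y≈x = ≈[]-sym (x≤x∨y _ _)

        -- By the triangle inequality, outside `d x y` the point `y` differs from `p` and `q`
        -- wherever `x` does, so `τ` fixes `y` there as well.
        ¬-bound : B.¬ (d y p B.∧ d y q) ≤ d x y B.∨ B.¬ (d x p B.∧ d x q)
        ¬-bound = ¬-≤-∨ (∨-∧-greatest (≤-trans (x∧y≤x _ _) (triangle _ _ _))
                                      (≤-trans (x∧y≤y _ _) (triangle _ _ _)))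

      τ-involutive : ∀ z → τ (τ z) ≈ z
      τ-involutive z = ≈[⊥]⇒≈ (cases z
        (λ z≈p → ≈[]-trans (τ≈p (τ≈q z≈p)) (≈[]-sym z≈p))
        (λ z≈q → ≈[]-trans (τ≈q (τ≈p z≈q)) (≈[]-sym z≈q))
        -- Contractivity carries the agreement of `τ z` with `z` over to that of `τ (τ z)` with
        -- `τ z`.
        (λ τz≈z → ≈[]-trans (≤-trans (τ-contractive _ _) τz≈z) τz≈z))

      transposition : Isometry X X
      transposition = contractiveInvolution⇒isometry τ τ-contractive τ-involutive

      τ-p≈q : τ p ≈ q
      τ-p≈q = ≈[⊥]⇒≈ (τ≈q (≈⇒≈[] EqC.refl))

      -- Equal distances make `z` equal to `p` exactly where it is equal to `q`. In that region the
      -- exchange sends `z` to a point that coincides with it.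
      τ-fixes-equidistant : ∀ {z} → d z p B.≈ d z q → τ z ≈ z
      τ-fixes-equidistant {z} dzp≈dzq = ≈[⊥]⇒≈ (cases z
        (λ z≈p → ≈[]-trans (τ≈q z≈p) (≈[]-sym (≤-trans (≤-reflexive (B.sym dzp≈dzq)) z≈p)))
        (λ z≈q → ≈[]-trans (τ≈p z≈q) (≈[]-sym (≤-trans (≤-reflexive dzp≈dzq) z≈q)))
        (λ τz≈z → τz≈z))

  -- Extension of isometric maps from a finitely generated space.

  module Extension (U : BooleanMetricSpace B c₁ e₁) (W : BooleanMetricSpace B c₂ e₂) where

    private
      module U = BooleanMetricSpace U
      module W = BooleanMetricSpace W
    open BooleanOrder B
    open Modulo W

    -- Surjectivity is not demanded, so that the inclusion of `U` and the map `F` followed by the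
    -- inclusion of `V` are treated alike.
    IsIsometric : (U.Carrier → W.Carrier) → Set _
    IsIsometric f = ∀ x y → W.d (f x) (f y) B.≈ U.d x y

    ≈[]-resp-isometric : ∀ {f} → IsIsometric f → ∀ {k x y} → U.d x y ≤ k → f x ≈[ k ] f y
    ≈[]-resp-isometric f-isometric = ≤-trans (≤-reflexive (f-isometric _ _))

    module _ {f g : U.Carrier → W.Carrier}
             (f-isometric : IsIsometric f) (g-isometric : IsIsometric g) where

      agree-mod : ∀ {k x y} → U.d x y ≤ k → f y W.≈ g y → f x ≈[ k ] g x
      agree-mod x≈y fy≈gy = ≈[]-trans (≈[]-resp-isometric f-isometric x≈y)
        (≈[]-trans (≈⇒≈[] fy≈gy) (≈[]-sym (≈[]-resp-isometric g-isometric x≈y)))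

      -- On each piece of the partition `x` coincides with a generator, so `f x` and `g x` coincide
      -- there. Their distance is thus disjoint from every piece, and the pieces cover `⊤`.
      agreeOnGenerators⇒agree : ∀ {S} → Generates U S →
        All (λ s → f s W.≈ g s) S → ∀ x → f x W.≈ g x
      agreeOnGenerators⇒agree generates agree x with generates x
      ... | _ , _ , _ , xs∈S , a-partition , x-combination =
        W.0⇒≈ (partition-disjoint a-partition (λ i → ≤¬⇒disjoint
          (agree-mod (disjoint⇒≤¬ (x-combination i))
                     (All.lookupₛ U.setoid respects agree (xs∈S i)))))
        where
        -- Membership in `S` holds only up to the equality of `U`, so agreement has to be invariant
        -- under it.
        respects : (λ s → f s W.≈ g s) Respects U._≈_
        respects s≈t fs≈gs = ≈[⊥]⇒≈ (agree-mod (≤-reflexive (U.≈⇒0 (U.EqC.sym s≈t))) fs≈gs)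

      extendFromList : Convex W → ∀ S →
        Σ[ G ∈ Isometry W W ] All (λ s → Isometry.to G (f s) W.≈ g s) S
      extendFromList convex []      = identity W , []
      extendFromList convex (u ∷ S) with extendFromList convex S
      ... | G , agree = compose G transposition , τ-p≈q ∷ All.map fixed agree
        where
        module G = Isometry G
        open Transposition {X = W} convex (G.to (f u)) (g u)
        open SetoidReasoning B.setoid

        equidistant : ∀ {s} → G.to (f s) W.≈ g s → W.d (g s) (G.to (f u)) B.≈ W.d (g s) (g u)
        equidistant {s} Gfs≈gs = begin
          W.d (g s) (G.to (f u))         ≈⟨ W.cong Gfs≈gs W.EqC.refl ⟨
          W.d (G.to (f s)) (G.to (f u))  ≈⟨ G.isometric _ _ ⟩
          W.d (f s) (f u)                ≈⟨ f-isometric _ _ ⟩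
          U.d s u                        ≈⟨ g-isometric _ _ ⟨
          W.d (g s) (g u)                ∎

        fixed : ∀ {s} → G.to (f s) W.≈ g s → τ (G.to (f s)) W.≈ g s
        fixed Gfs≈gs = W.EqC.trans
          (Bijection.cong (Isometry.bijection transposition) Gfs≈gs)
          (τ-fixes-equidistant (equidistant Gfs≈gs))

    ultrahomogeneous : Convex W → FinitelyGenerated U → ∀ {f g} →
      IsIsometric f → IsIsometric g →
      Σ[ G ∈ Isometry W W ] (∀ x → Isometry.to G (f x) W.≈ g x)
    ultrahomogeneous convex (S , generates) {f} {g} f-isometric g-isometric
      with extendFromList f-isometric g-isometric convex S
    -- The map `f` followed by `G` is again isometric, so it can be compared with `g` on the
    -- generators.
    ... | G , agree = G , agreeOnGenerators⇒agree
      (λ x y → B.trans (Isometry.isometric G _ _) (f-isometric x y)) g-isometric generates agree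

theorem2 : ∀ {b ℓ c e u v} (B : BooleanAlgebra b ℓ) (W : BooleanMetricSpace B c e) →
    let module W = BooleanMetricSpace W in
    (U : Pred W.Carrier u) (V : Pred W.Carrier v) →
    U Respects W._≈_ → V Respects W._≈_ →
    IsCFGSpace (Subspace W U) → IsCFGSpace (Subspace W V) → IsCFGSpace W →
    (F : Isometry (Subspace W U) (Subspace W V)) →
    Σ[ F′ ∈ Isometry W W ]
    (∀ w (w∈U : U w) → Isometry.to F′ w W.≈ proj₁ (Isometry.to F (w , w∈U)))
theorem2 B W U V _ _ U-cfg _ W-cfg F =
  let G , G-extends = Extension.ultrahomogeneous (Subspace W U) W
        (IsCFGSpace.convex W-cfg) (IsCFGSpace.finitelyGenerated U-cfg)
        -- Here `f` is the inclusion of `U` in `W`, isometric by reflexivity because `U` carries the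
        -- restricted metric.
        {f = proj₁} {g = λ x → proj₁ (Isometry.to F x)}
        (λ _ _ → BooleanAlgebra.refl B) (Isometry.isometric F)
  in G , λ w w∈U → G-extends (w , w∈U)
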